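{- Let $t\in\mathcal T_\lambda$, let $\Gamma$ be a typing context and $\sigma$ a type. (1) $\Gamma\vdash t:\sigma$ is derivable in system $\mathcal N$ if and only if $\Gamma\vdash t^{\mathsf{cbn}}:\sigma$ is derivable in system $\mathcal U$. (2) $\Gamma\vdash t:\sigma$ is derivable in system $\mathcal V$ if and only if $\Gamma\vdash t^{\mathsf{cbv}}:\sigma$ is derivable in system $\mathcal U$.
   Context: Source terms $\mathcal T_\lambda$: $t,u ::= x\mid\lambda x.t\mid t\,u\mid t[x\backslash u]$. Target terms ($\lambda!$-calculus): $t,u ::= x \mid t\,u \mid \lambda x.t \mid {!t} \mid \mathrm{der}\,t \mid t[x\backslash u]$. Here $[x\backslash u]$ is a syntactic explicit substitution; $\lambda x.t$ and $t[x\backslash u]$ bind $x$ in $t$; terms are modulo $\alpha$-conversion. List contexts: $L ::= \Box\mid L[x\backslash t]$; $L\langle s\rangle$ plugs $s$ in the hole (variables may be captured). Embeddings $\mathcal T_\lambda\to\lambda!$: $x^{\mathsf{cbn}}=x$, $(\lambda x.t)^{\mathsf{cbn}}=\lambda x.t^{\mathsf{cbn}}$, $(t\,u)^{\mathsf{cbn}}=t^{\mathsf{cbn}}\,{!u^{\mathsf{cbn}}}$, $(t[x\backslash u])^{\mathsf{cbn}}=t^{\mathsf{cbn}}[x\backslash{!u^{\mathsf{cbn}}}]$; $x^{\mathsf{cbv}}={!x}$, $(\lambda x.t)^{\mathsf{cbv}}={!(\lambda x.t^{\mathsf{cbv}})}$, $(t\,u)^{\mathsf{cbv}}=L\langle s\rangle\,u^{\mathsf{cbv}}$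 if $t^{\mathsf{cbv}}=L\langle{!s}\rangle$ for some list context $L$ and term $s$, and $(t\,u)^{\mathsf{cbv}}=\mathrm{der}(t^{\mathsf{cbv}})\,u^{\mathsf{cbv}}$ otherwise; $(t[x\backslash u])^{\mathsf{cbv}}=t^{\mathsf{cbv}}[x\backslash u^{\mathsf{cbv}}]$. Types (same for the three systems): $\sigma,\tau ::= \alpha \mid M \mid M\to\sigma$, with $\alpha$ in a countably infinite set of base types and $M ::= [\sigma_i]_{i\in I}$ a finite (possibly empty) multiset of types. Typing contexts $\Gamma,\Delta$ map variables to multiset types, all but finitely many to the empty multiset $[\,]$; $+$ is pointwise multiset union; $\Gamma\setminus\!\!\setminus x$ maps $x$ to $[\,]$ and agrees with $\Gamma$ elsewhere; $x:M$ is the context mapping $x$ to $M$ and all others to $[\,]$; $\Gamma;x:M$ denotes the context equal to $M$ on $x$ and to $\Gamma$ elsewhere, where $\Gamma(x)=[\,]$. All index sets $I$ are finite, possibly empty. System $\mathcal U$ (on $\lambda!$-terms): (ax) $x:[\sigma]\vdash x:\sigma$; (es) from $\Gamma\vdash t:\sigma$ and $\Delta\vdash u:\Gamma(x)$ infer $(\Gamma\setminus\!\!\setminus x)+\Delta\vdash t[x\backslash u]:\sigma$; (abs) from $\Gamma\vdash t:\tau$ infer $\Gamma\setminus\!\!\setminus x\vdash\lambda x.t:\Gamma(x)\to\tau$; (app) from $\Gamma\vdash t:M\to\tau$ and $\Delta\vdash u:M$ infer $\Gamma+\Delta\vdash t\,u:\tau$; (bg) from $(\Gamma_i\vdash t:\sigma_i)_{i\in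 I}$ infer $+_{i\in I}\Gamma_i\vdash{!t}:[\sigma_i]_{i\in I}$; (dr) from $\Gamma\vdash t:[\sigma]$ infer $\Gamma\vdash\mathrm{der}\,t:\sigma$. System $\mathcal N$ (on $\mathcal T_\lambda$): $(\mathrm{ax}_n)$ $x:[\sigma]\vdash x:\sigma$; $(\mathrm{es}_n)$ from $\Gamma;x:[\sigma_i]_{i\in I}\vdash t:\tau$ and $(\Delta_i\vdash u:\sigma_i)_{i\in I}$ infer $\Gamma+_{i\in I}\Delta_i\vdash t[x\backslash u]:\tau$; $(\mathrm{abs}_n)$ from $\Gamma\vdash t:\tau$ infer $\Gamma\setminus\!\!\setminus x\vdash\lambda x.t:\Gamma(x)\to\tau$; $(\mathrm{app}_n)$ from $\Gamma\vdash t:[\sigma_i]_{i\in I}\to\tau$ and $(\Delta_i\vdash u:\sigma_i)_{i\in I}$ infer $\Gamma+_{i\in I}\Delta_i\vdash t\,u:\tau$. System $\mathcal V$ (on $\mathcal T_\lambda$): $(\mathrm{ax}_v)$ $x:M\vdash x:M$; $(\mathrm{es}_v)$ from $\Gamma\vdash t:\sigma$ and $\Delta\vdash u:\Gamma(x)$ infer $(\Gamma\setminus\!\!\setminus x)+\Delta\vdash t[x\backslash u]:\sigma$; $(\mathrm{abs}_v)$ from $(\Gamma_i\vdash t:\tau_i)_{i\in I}$ infer $+_{i\in I}(\Gamma_i\setminus\!\!\setminus x)\vdash\lambda x.t:[\Gamma_i(x)\to\tau_i]_{i\in I}$; $(\mathrm{app}_v)$ from $\Gamma\vdash t:[M\to\tau]$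 and $\Delta\vdash u:M$ infer $\Gamma+\Delta\vdash t\,u:\tau$. -}

module Defs where

open import Data.Fin using (Fin)
open import Data.List using (List; []; _∷_; [_]; _++_; tabulate)
open import Data.List.Relation.Binary.Permutation.Homogeneous using (Permutation)
import Data.List.Relation.Binary.Permutation.Homogeneous as Perm
import Data.List.Relation.Binary.Pointwise.Base as ListPW
open import Data.Nat using (ℕ; suc)
open import Data.Product using (Σ-syntax; _,_)
open import Data.Vec using (Vec; []; _∷_; replicate; zipWith; _[_]≔_)
open import Data.Vec.Functional using (foldr)
open import Data.Vec.Relation.Binary.Pointwise.Inductive using (Pointwise)
open import Relation.Binary.PropositionalEquality using (_≡_; refl)
open import Relation.Binary.Structures using (IsEquivalence)
open import Relation.Nullary using (Dec; yes; no)

infixl 7 _·_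
infixl 9 _⟪_⟫
infixr 8 !_
infixr 6 ƛ_

-- Terms modulo α-conversion are well-scoped de Bruijn terms: Λ n and Λ! n
-- hold the terms whose free variables are among n given ones.
-- t ⟪ u ⟫ is the explicit substitution t[x\u]; it binds variable 0 in t only.

data Λ (n : ℕ) : Set where
  var   : Fin n → Λ n
  ƛ_    : Λ (suc n) → Λ n
  _·_   : Λ n → Λ n → Λ n
  _⟪_⟫  : Λ (suc n) → Λ n → Λ n

data Λ! (n : ℕ) : Set where
  var   : Fin n → Λ! n
  _·_   : Λ! n → Λ! n → Λ! n
  ƛ_    : Λ! (suc n) → Λ! n
  !_    : Λ! n → Λ! n
  der   : Λ! n → Λ! n
  _⟪_⟫  : Λ! (suc n) → Λ! n → Λ! n

-- A list context in scope n whose hole is in scope m (m ≥ n, since the hole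
-- lies under all the binders of the context and may be captured by them).

data LCtx (n : ℕ) : ℕ → Set where
  □     : LCtx n n
  _⟪_⟫  : ∀ {m} → LCtx (suc n) m → Λ! n → LCtx n m

_⟨_⟩ : ∀ {n m} → LCtx n m → Λ! m → Λ! n
□           ⟨ s ⟩ = s
(L ⟪ u ⟫)   ⟨ s ⟩ = (L ⟨ s ⟩) ⟪ u ⟫

BangUnderL : ∀ {n} → Λ! n → Set
BangUnderL {n} t = Σ[ m ∈ ℕ ] Σ[ L ∈ LCtx n m ] Σ[ s ∈ Λ! m ] t ≡ L ⟨ ! s ⟩

bangUnderL? : ∀ {n} (t : Λ! n) → Dec (BangUnderL t)
bangUnderL? (var x) = no λ { (_ , □ , _ , ()) ; (_ , _ ⟪ _ ⟫ , _ , ()) }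
bangUnderL? (t · u) = no λ { (_ , □ , _ , ()) ; (_ , _ ⟪ _ ⟫ , _ , ()) }
bangUnderL? (ƛ t)   = no λ { (_ , □ , _ , ()) ; (_ , _ ⟪ _ ⟫ , _ , ()) }
bangUnderL? (der t) = no λ { (_ , □ , _ , ()) ; (_ , _ ⟪ _ ⟫ , _ , ()) }
bangUnderL? (! t)   = yes (_ , □ , t , refl)
bangUnderL? (t ⟪ u ⟫) with bangUnderL? t
... | yes (m , L , s , refl) = yes (m , L ⟪ u ⟫ , s , refl)
... | no ¬p = no λ { (_ , □ , _ , ()) ; (m , L ⟪ _ ⟫ , s , refl) → ¬p (m , L , s , refl) }

cbn : ∀ {n} → Λ n → Λ! n
cbn (var x)   = var x
cbn (ƛ t)     = ƛ cbn t
cbn (t · u)   = cbn t · (! cbn u)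
cbn (t ⟪ u ⟫) = cbn t ⟪ ! cbn u ⟫

cbv : ∀ {n} → Λ n → Λ! n
cbv (var x)   = ! var x
cbv (ƛ t)     = ! (ƛ cbv t)
cbv (t · u) with bangUnderL? (cbv t)
... | yes (_ , L , s , _) = (L ⟨ s ⟩) · cbv u
... | no _                = der (cbv t) · cbv u
cbv (t ⟪ u ⟫) = cbv t ⟪ cbv u ⟫

-- A multiset of types is represented by a list. Equality of types is then
-- _≈_, which permutes multisets at every depth.

infixr 5 _⇒_

mutual
  data Ty : Set where
    base : ℕ → Ty
    mset : MTy → Ty
    _⇒_  : MTy → Ty → Ty

  MTy : Set
  MTy = List Ty

infix 4 _≈_ _≈ₘ_ _≈ᶜ_

mutual
  data _≈_ : Ty → Ty → Set where
    base : ∀ {a} → base a ≈ base a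
    mset : ∀ {M N} → M ≈ₘ N → mset M ≈ mset N
    _⇒_  : ∀ {M N σ τ} → M ≈ₘ N → σ ≈ τ → M ⇒ σ ≈ N ⇒ τ

  _≈ₘ_ : MTy → MTy → Set
  _≈ₘ_ = Permutation _≈_

mutual
  ≈-refl : ∀ σ → σ ≈ σ
  ≈-refl (base a) = base
  ≈-refl (mset M) = mset (≈ₘ-refl M)
  ≈-refl (M ⇒ σ)  = ≈ₘ-refl M ⇒ ≈-refl σ

  ≈ₘ-refl : ∀ M → M ≈ₘ M
  ≈ₘ-refl []      = Perm.refl ListPW.[]
  ≈ₘ-refl (σ ∷ M) = Perm.prep (≈-refl σ) (≈ₘ-refl M)

mutual
  ≈-sym : ∀ {σ τ} → σ ≈ τ → τ ≈ σ
  ≈-sym base     = base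
  ≈-sym (mset p) = mset (≈ₘ-sym p)
  ≈-sym (p ⇒ q)  = ≈ₘ-sym p ⇒ ≈-sym q

  ≈ₘ-sym : ∀ {M N} → M ≈ₘ N → N ≈ₘ M
  ≈ₘ-sym (Perm.refl ps)    = Perm.refl (≋-sym ps)
  ≈ₘ-sym (Perm.prep e p)   = Perm.prep (≈-sym e) (≈ₘ-sym p)
  ≈ₘ-sym (Perm.swap e f p) = Perm.swap (≈-sym f) (≈-sym e) (≈ₘ-sym p)
  ≈ₘ-sym (Perm.trans p q)  = Perm.trans (≈ₘ-sym q) (≈ₘ-sym p)

  ≋-sym : ∀ {M N} → ListPW.Pointwise _≈_ M N → ListPW.Pointwise _≈_ N M
  ≋-sym ListPW.[]       = ListPW.[]
  ≋-sym (e ListPW.∷ es) = ≈-sym e ListPW.∷ ≋-sym es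

≈-trans : ∀ {σ τ ρ} → σ ≈ τ → τ ≈ ρ → σ ≈ ρ
≈-trans base     base       = base
≈-trans (mset p) (mset q)   = mset (Perm.trans p q)
≈-trans (p ⇒ e)  (q ⇒ f)    = Perm.trans p q ⇒ ≈-trans e f

≈-isEquivalence : IsEquivalence _≈_
≈-isEquivalence = record { refl = ≈-refl _ ; sym = ≈-sym ; trans = ≈-trans }

-- Typing contexts for terms in Λ n or Λ! n. In M ∷ Γ the bound variable 0 has
-- multiset M, so on a context M ∷ Γ, "Γ(x)" is M and "Γ without x" is Γ.

Ctx : ℕ → Set
Ctx n = Vec MTy n

_≈ᶜ_ : ∀ {n} → Ctx n → Ctx n → Set
_≈ᶜ_ = Pointwise _≈ₘ_

∅ : ∀ {n} → Ctx n
∅ {n} = replicate n []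

infixl 6 _⊎_
infix  7 _↦_

_↦_ : ∀ {n} → Fin n → MTy → Ctx n
x ↦ M = ∅ [ x ]≔ M

_⊎_ : ∀ {n} → Ctx n → Ctx n → Ctx n
_⊎_ = zipWith _++_

⨄ : ∀ {n k} → (Fin k → Ctx n) → Ctx n
⨄ = foldr _⊎_ ∅

-- Finite index sets I are Fin k, and [σ_i]_{i∈I} is tabulate σ. Judgements speak about multisets, not lists,
-- so each system has a rule conv identifying judgements with equal (≈ᶜ, ≈)
-- contexts and types; it plays the role of the missing quotient.

infix 3 _⊢ᵁ_∶_ _⊢ᴺ_∶_ _⊢ⱽ_∶_

data _⊢ᵁ_∶_ {n : ℕ} : Ctx n → Λ! n → Ty → Set where

  ax   : ∀ {x σ} →
         x ↦ [ σ ] ⊢ᵁ var x ∶ σ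

  es   : ∀ {Γ Δ M t u σ} →
         M ∷ Γ ⊢ᵁ t ∶ σ →
         Δ ⊢ᵁ u ∶ mset M →
         Γ ⊎ Δ ⊢ᵁ t ⟪ u ⟫ ∶ σ

  abs  : ∀ {Γ M t τ} →
         M ∷ Γ ⊢ᵁ t ∶ τ →
         Γ ⊢ᵁ ƛ t ∶ M ⇒ τ

  app  : ∀ {Γ Δ M t u τ} →
         Γ ⊢ᵁ t ∶ M ⇒ τ →
         Δ ⊢ᵁ u ∶ mset M →
         Γ ⊎ Δ ⊢ᵁ t · u ∶ τ

  bg   : ∀ {k t} {Γ : Fin k → Ctx n} {σ : Fin k → Ty} →
         (∀ i → Γ i ⊢ᵁ t ∶ σ i) →
         ⨄ Γ ⊢ᵁ ! t ∶ mset (tabulate σ)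

  dr   : ∀ {Γ t σ} →
         Γ ⊢ᵁ t ∶ mset [ σ ] →
         Γ ⊢ᵁ der t ∶ σ

  conv : ∀ {Γ Γ′ t σ σ′} →
         Γ ≈ᶜ Γ′ → σ ≈ σ′ →
         Γ ⊢ᵁ t ∶ σ →
         Γ′ ⊢ᵁ t ∶ σ′

data _⊢ᴺ_∶_ {n : ℕ} : Ctx n → Λ n → Ty → Set where

  ax   : ∀ {x σ} →
         x ↦ [ σ ] ⊢ᴺ var x ∶ σ

  es   : ∀ {k Γ t u τ} {Δ : Fin k → Ctx n} {σ : Fin k → Ty} →
         tabulate σ ∷ Γ ⊢ᴺ t ∶ τ →
         (∀ i → Δ i ⊢ᴺ u ∶ σ i) →
         Γ ⊎ ⨄ Δ ⊢ᴺ t ⟪ u ⟫ ∶ τ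

  abs  : ∀ {Γ M t τ} →
         M ∷ Γ ⊢ᴺ t ∶ τ →
         Γ ⊢ᴺ ƛ t ∶ M ⇒ τ

  app  : ∀ {k Γ t u τ} {Δ : Fin k → Ctx n} {σ : Fin k → Ty} →
         Γ ⊢ᴺ t ∶ tabulate σ ⇒ τ →
         (∀ i → Δ i ⊢ᴺ u ∶ σ i) →
         Γ ⊎ ⨄ Δ ⊢ᴺ t · u ∶ τ

  conv : ∀ {Γ Γ′ t σ σ′} →
         Γ ≈ᶜ Γ′ → σ ≈ σ′ →
         Γ ⊢ᴺ t ∶ σ →
         Γ′ ⊢ᴺ t ∶ σ′

data _⊢ⱽ_∶_ {n : ℕ} : Ctx n → Λ n → Ty → Set where

  ax   : ∀ {x M} →
         x ↦ M ⊢ⱽ var x ∶ mset M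

  es   : ∀ {Γ Δ M t u σ} →
         M ∷ Γ ⊢ⱽ t ∶ σ →
         Δ ⊢ⱽ u ∶ mset M →
         Γ ⊎ Δ ⊢ⱽ t ⟪ u ⟫ ∶ σ

  abs  : ∀ {k t} {Γ : Fin k → Ctx n} {M : Fin k → MTy} {τ : Fin k → Ty} →
         (∀ i → M i ∷ Γ i ⊢ⱽ t ∶ τ i) →
         ⨄ Γ ⊢ⱽ ƛ t ∶ mset (tabulate λ i → M i ⇒ τ i)

  app  : ∀ {Γ Δ M t u τ} →
         Γ ⊢ⱽ t ∶ mset [ M ⇒ τ ] →
         Δ ⊢ⱽ u ∶ mset M →
         Γ ⊎ Δ ⊢ⱽ t · u ∶ τ

  conv : ∀ {Γ Γ′ t σ σ′} →
         Γ ≈ᶜ Γ′ → σ ≈ σ′ →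
         Γ ⊢ⱽ t ∶ σ →
         Γ′ ⊢ⱽ t ∶ σ′

{-# OPTIONS --safe #-}
module Submission where

open import Defs
open import Data.Fin using (Fin; zero; suc)
open import Data.List using ([]; _∷_; [_]; _++_; tabulate; length; lookup)
open import Data.List.Properties using (tabulate-lookup; ++-identityʳ)
import Data.List.Relation.Binary.Permutation.Homogeneous as Perm
import Data.List.Relation.Binary.Permutation.Setoid.Properties as PermProps
import Data.List.Relation.Binary.Pointwise as ListPW
open import Data.Nat using (ℕ; zero; suc)
open import Data.Product using (_×_; _,_; ∃-syntax; proj₁; proj₂)
open import Data.Vec using (_∷_)
open import Data.Vec.Properties using (zipWith-identityʳ)
import Data.Vec.Relation.Binary.Pointwise.Inductive as VecPW
open VecPW using (_∷_)
open import Function.Base using (_∘_)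
open import Function.Bundles using (_⇔_; mk⇔)
open import Relation.Binary.Bundles using (Setoid)
open import Relation.Binary.PropositionalEquality using (_≡_; refl; sym; trans; cong; subst₂)
open import Relation.Nullary using (yes; no)

-- The inversion lemmas absorb the uses of conv at the root of a derivation.
-- Each converse translation is then an induction on the source term: its cbn
-- or cbv image determines the last rules of the derivation in 𝒰. The only
-- other ingredient is that typing L⟨!s⟩ with [σ] amounts to typing L⟨s⟩ with
-- σ, because a singleton multiset forces the rule (bg) to have one premise.

Ty-setoid : Setoid _ _
Ty-setoid = record { isEquivalence = ≈-isEquivalence }

≈ᶜ-refl : ∀ {n} {Γ : Ctx n} → Γ ≈ᶜ Γ
≈ᶜ-refl = VecPW.refl (≈ₘ-refl _)

≈ᶜ-reflexive : ∀ {n} {Γ Δ : Ctx n} → Γ ≡ Δ → Γ ≈ᶜ Δ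
≈ᶜ-reflexive refl = ≈ᶜ-refl

≈ᶜ-trans : ∀ {n} {Γ Δ Θ : Ctx n} → Γ ≈ᶜ Δ → Δ ≈ᶜ Θ → Γ ≈ᶜ Θ
≈ᶜ-trans = VecPW.trans Perm.trans

↦-cong : ∀ {n M N} (x : Fin n) → M ≈ₘ N → x ↦ M ≈ᶜ x ↦ N
↦-cong zero    p = p ∷ ≈ᶜ-refl
↦-cong (suc x) p = ≈ₘ-refl [] ∷ ↦-cong x p

⊎-cong : ∀ {n} {Γ Γ′ Δ Δ′ : Ctx n} → Γ ≈ᶜ Γ′ → Δ ≈ᶜ Δ′ → Γ ⊎ Δ ≈ᶜ Γ′ ⊎ Δ′
⊎-cong = VecPW.zipWith-cong (PermProps.++⁺ Ty-setoid)

⨄-cong : ∀ {n} k {Γ Δ : Fin k → Ctx n} → (∀ i → Γ i ≈ᶜ Δ i) → ⨄ Γ ≈ᶜ ⨄ Δ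
⨄-cong zero    p = ≈ᶜ-refl
⨄-cong (suc k) p = ⊎-cong (p zero) (⨄-cong k (p ∘ suc))

⊎-identityʳ : ∀ {n} (Γ : Ctx n) → Γ ⊎ ∅ ≡ Γ
⊎-identityʳ = zipWith-identityʳ ++-identityʳ

↦-[] : ∀ {n} (x : Fin n) → x ↦ [] ≡ ∅
↦-[] zero    = refl
↦-[] (suc x) = cong ([] ∷_) (↦-[] x)

↦-++ : ∀ {n} (x : Fin n) M N → (x ↦ M) ⊎ (x ↦ N) ≡ x ↦ (M ++ N)
↦-++ zero    M N = cong ((M ++ N) ∷_) (⊎-identityʳ ∅)
↦-++ (suc x) M N = cong ([] ∷_) (↦-++ x M N)

-- This matches a family of axioms under (bg) in 𝒰 with the single axiom of 𝒱, which gives `x` a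
-- whole multiset at once.
⨄-↦ : ∀ {n} (x : Fin n) k (σ : Fin k → Ty) → ⨄ (λ i → x ↦ [ σ i ]) ≡ x ↦ tabulate σ
⨄-↦ x zero    σ = sym (↦-[] x)
⨄-↦ x (suc k) σ = trans (cong ((x ↦ [ σ zero ]) ⊎_) (⨄-↦ x k (σ ∘ suc)))
                        (↦-++ x [ σ zero ] (tabulate (σ ∘ suc)))

tabulate-≈ₘ : ∀ k {σ τ : Fin k → Ty} → (∀ i → σ i ≈ τ i) → tabulate σ ≈ₘ tabulate τ
tabulate-≈ₘ k p = Perm.refl (ListPW.tabulate⁺ p)

≈ₘ-[]⁻¹ : ∀ {M} → M ≈ₘ [] → M ≡ []
≈ₘ-[]⁻¹ (Perm.refl ListPW.[]) = refl
≈ₘ-[]⁻¹ (Perm.trans p q) with refl ← ≈ₘ-[]⁻¹ q = ≈ₘ-[]⁻¹ p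

-- `swap` is excluded by length. In a `trans`, the right half is inverted first: it forces the
-- intermediate list to be a singleton, so that the left half can be inverted as well.
≈ₘ-singleton⁻¹ : ∀ {M τ} → M ≈ₘ [ τ ] → ∃[ σ ] M ≡ [ σ ] × σ ≈ τ
≈ₘ-singleton⁻¹ (Perm.refl (e ListPW.∷ ListPW.[])) = _ , refl , e
≈ₘ-singleton⁻¹ (Perm.prep e p) with refl ← ≈ₘ-[]⁻¹ p = _ , refl , e
≈ₘ-singleton⁻¹ (Perm.trans p q)
  with _ , refl , e ← ≈ₘ-singleton⁻¹ q
  with _ , refl , f ← ≈ₘ-singleton⁻¹ p = _ , refl , ≈-trans f e

var⁻¹ : ∀ {n} {Γ : Ctx n} {x σ} → Γ ⊢ᵁ var x ∶ σ → x ↦ [ σ ] ≈ᶜ Γ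
var⁻¹ ax           = ≈ᶜ-refl
var⁻¹ (conv p q d) = ≈ᶜ-trans (↦-cong _ (Perm.prep (≈-sym q) (≈ₘ-refl []))) (≈ᶜ-trans (var⁻¹ d) p)

-- The body and the conclusion share their type, so a type conversion moves into the premise on `t`;
-- only the context conversion has to be recorded.
es⁻¹ : ∀ {n} {Γ : Ctx n} {t u σ} → Γ ⊢ᵁ t ⟪ u ⟫ ∶ σ →
       ∃[ Γ₁ ] ∃[ Γ₂ ] ∃[ M ] (M ∷ Γ₁ ⊢ᵁ t ∶ σ) × (Γ₂ ⊢ᵁ u ∶ mset M) × Γ₁ ⊎ Γ₂ ≈ᶜ Γ
es⁻¹ (es d e) = _ , _ , _ , d , e , ≈ᶜ-refl
es⁻¹ (conv p q d) with _ , _ , _ , d₁ , d₂ , r ← es⁻¹ d =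
  _ , _ , _ , conv ≈ᶜ-refl q d₁ , d₂ , ≈ᶜ-trans r p

app⁻¹ : ∀ {n} {Γ : Ctx n} {t u τ} → Γ ⊢ᵁ t · u ∶ τ →
        ∃[ Γ₁ ] ∃[ Γ₂ ] ∃[ M ] (Γ₁ ⊢ᵁ t ∶ M ⇒ τ) × (Γ₂ ⊢ᵁ u ∶ mset M) × Γ₁ ⊎ Γ₂ ≈ᶜ Γ
app⁻¹ (app d e) = _ , _ , _ , d , e , ≈ᶜ-refl
app⁻¹ (conv p q d) with _ , _ , _ , d₁ , d₂ , r ← app⁻¹ d =
  _ , _ , _ , conv ≈ᶜ-refl (≈ₘ-refl _ ⇒ q) d₁ , d₂ , ≈ᶜ-trans r p

abs⁻¹ : ∀ {n} {Γ : Ctx n} {t σ} → Γ ⊢ᵁ ƛ t ∶ σ →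
        ∃[ M ] ∃[ τ ] (M ∷ Γ ⊢ᵁ t ∶ τ) × M ⇒ τ ≈ σ
abs⁻¹ (abs d) = _ , _ , d , ≈-refl _
abs⁻¹ (conv p q d) with _ , _ , d₁ , r ← abs⁻¹ d =
  _ , _ , conv (≈ₘ-refl _ ∷ p) (≈-refl _) d₁ , ≈-trans r q

bg⁻¹ : ∀ {n} {Γ : Ctx n} {t σ} → Γ ⊢ᵁ ! t ∶ σ →
       ∃[ k ] ∃[ Δ ] ∃[ τ ] ((i : Fin k) → Δ i ⊢ᵁ t ∶ τ i) × ⨄ Δ ≈ᶜ Γ × mset (tabulate τ) ≈ σ
bg⁻¹ (bg d) = _ , _ , _ , d , ≈ᶜ-refl , ≈-refl _
bg⁻¹ (conv p q d) with _ , _ , _ , ds , r , s ← bg⁻¹ d =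
  _ , _ , _ , ds , ≈ᶜ-trans r p , ≈-trans s q

der⁻¹ : ∀ {n} {Γ : Ctx n} {t σ} → Γ ⊢ᵁ der t ∶ σ → Γ ⊢ᵁ t ∶ mset [ σ ]
der⁻¹ (dr d)       = d
der⁻¹ (conv p q d) = conv p (mset (Perm.prep q (≈ₘ-refl []))) (der⁻¹ d)

-- Each layer of `L` is an (es) step, which passes the type of its body through unchanged; at the
-- hole, (bg) is used with exactly one premise.
bang : ∀ {n m} {Γ : Ctx n} (L : LCtx n m) {s σ} → Γ ⊢ᵁ L ⟨ s ⟩ ∶ σ → Γ ⊢ᵁ L ⟨ ! s ⟩ ∶ mset [ σ ]
bang □         d = conv (≈ᶜ-reflexive (⊎-identityʳ _)) (≈-refl _) (bg {k = 1} λ _ → d)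
bang (L ⟪ u ⟫) d with _ , _ , _ , d₁ , d₂ , p ← es⁻¹ d = conv p (≈-refl _) (es (bang L d₁) d₂)

unbang : ∀ {n m} {Γ : Ctx n} (L : LCtx n m) {s σ} → Γ ⊢ᵁ L ⟨ ! s ⟩ ∶ mset [ σ ] → Γ ⊢ᵁ L ⟨ s ⟩ ∶ σ
-- The list `tabulate τ` of `k` premise types is a permutation of a singleton, which refutes every
-- `k` except 1.
unbang □ d with bg⁻¹ d
... | 0           , _ , _ , _  , _ , mset q with _ , () , _ ← ≈ₘ-singleton⁻¹ q
... | suc (suc _) , _ , _ , _  , _ , mset q with _ , () , _ ← ≈ₘ-singleton⁻¹ q
... | 1           , _ , _ , ds , p , mset q with _ , refl , e ← ≈ₘ-singleton⁻¹ q =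
  conv (≈ᶜ-trans (≈ᶜ-reflexive (sym (⊎-identityʳ _))) p) e (ds zero)
unbang (L ⟪ u ⟫) d with _ , _ , _ , d₁ , d₂ , p ← es⁻¹ d = conv p (≈-refl _) (es (unbang L d₁) d₂)

cbn-sound : ∀ {n t} {Γ : Ctx n} {σ} → Γ ⊢ᴺ t ∶ σ → Γ ⊢ᵁ cbn t ∶ σ
cbn-sound ax           = ax
cbn-sound (es d ds)    = es (cbn-sound d) (bg λ i → cbn-sound (ds i))
cbn-sound (abs d)      = abs (cbn-sound d)
cbn-sound (app d ds)   = app (cbn-sound d) (bg λ i → cbn-sound (ds i))
cbn-sound (conv p q d) = conv p q (cbn-sound d)

cbn-complete : ∀ {n} t {Γ : Ctx n} {σ} → Γ ⊢ᵁ cbn t ∶ σ → Γ ⊢ᴺ t ∶ σ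
cbn-complete (var x) d = conv (var⁻¹ d) (≈-refl _) ax
cbn-complete (ƛ t) d with _ , _ , d₁ , p ← abs⁻¹ d = conv ≈ᶜ-refl p (abs (cbn-complete t d₁))
cbn-complete (t · u) d
  with _ , _ , _ , d₁ , d₂ , p ← app⁻¹ d
  with _ , _ , _ , ds , q , mset r ← bg⁻¹ d₂ =
  conv (≈ᶜ-trans (⊎-cong ≈ᶜ-refl q) p) (≈-refl _)
    -- (app) of 𝒩 wants the domain to be literally the tabulated argument types, whereas `r` yields
    -- it only up to `≈ₘ`; converting the premise on `t` closes the gap.
    (app (conv ≈ᶜ-refl (≈ₘ-sym r ⇒ ≈-refl _) (cbn-complete t d₁)) (λ i → cbn-complete u (ds i)))
cbn-complete (t ⟪ u ⟫) d
  with _ , _ , _ , d₁ , d₂ , p ← es⁻¹ d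
  with _ , _ , _ , ds , q , mset r ← bg⁻¹ d₂ =
  conv (≈ᶜ-trans (⊎-cong ≈ᶜ-refl q) p) (≈-refl _)
    (es (conv (≈ₘ-sym r ∷ ≈ᶜ-refl) (≈-refl _) (cbn-complete t d₁)) (λ i → cbn-complete u (ds i)))

-- (bg) takes one axiom per position of `M`, hence no premise at all when `M` is empty.
bang-var : ∀ {n} (x : Fin n) M → x ↦ M ⊢ᵁ ! var x ∶ mset M
bang-var x M =
  subst₂ (λ Γ N → Γ ⊢ᵁ ! var x ∶ mset N)
    (trans (⨄-↦ x (length M) (lookup M)) (cong (x ↦_) (tabulate-lookup M)))
    (tabulate-lookup M)
    (bg {Γ = λ i → x ↦ [ lookup M i ]} λ i → ax)

cbv-sound : ∀ {n t} {Γ : Ctx n} {σ} → Γ ⊢ⱽ t ∶ σ → Γ ⊢ᵁ cbv t ∶ σ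
cbv-sound ax           = bang-var _ _
cbv-sound (es d e)     = es (cbv-sound d) (cbv-sound e)
cbv-sound (abs ds)     = bg λ i → abs (cbv-sound (ds i))
-- The derivation for `t` is abstracted along with the test, so that `rewrite eq` makes `L ⟨ ! s ⟩`
-- its subject and `unbang` applies.
cbv-sound {t = t · u} (app d e) with bangUnderL? (cbv t) | cbv-sound d
... | yes (_ , L , s , eq) | d′ rewrite eq = app (unbang L d′) (cbv-sound e)
... | no _                 | d′ = app (dr d′) (cbv-sound e)
cbv-sound (conv p q d) = conv p q (cbv-sound d)

cbv-complete : ∀ {n} t {Γ : Ctx n} {σ} → Γ ⊢ᵁ cbv t ∶ σ → Γ ⊢ⱽ t ∶ σ
cbv-complete (var x) d with k , _ , τ , ds , p , q ← bg⁻¹ d =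
  -- Every premise types `x` itself, so its context is `x ↦ [ τ i ]` up to `≈ᶜ`; these add up to the
  -- context of (ax) at `tabulate τ`.
  conv (≈ᶜ-trans (≈ᶜ-reflexive (sym (⨄-↦ x k τ))) (≈ᶜ-trans (⨄-cong k (λ i → var⁻¹ (ds i))) p)) q ax
cbv-complete (ƛ t) d with k , _ , _ , ds , p , q ← bg⁻¹ d =
  conv p (≈-trans (mset (tabulate-≈ₘ k λ i → proj₂ (proj₂ (proj₂ (abs⁻¹ (ds i)))))) q)
    (abs λ i → cbv-complete t (proj₁ (proj₂ (proj₂ (abs⁻¹ (ds i))))))
-- The induction hypothesis needs `cbv t` typed by a singleton multiset: `bang` supplies this from
-- the typing of `L ⟨ s ⟩`, and `der⁻¹` from that of `der (cbv t)`.
cbv-complete (t · u) d with bangUnderL? (cbv t) | cbv-complete t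
... | yes (_ , L , s , eq) | ih rewrite eq
  with _ , _ , _ , d₁ , d₂ , p ← app⁻¹ d = conv p (≈-refl _) (app (ih (bang L d₁)) (cbv-complete u d₂))
... | no _                 | ih
  with _ , _ , _ , d₁ , d₂ , p ← app⁻¹ d = conv p (≈-refl _) (app (ih (der⁻¹ d₁)) (cbv-complete u d₂))
cbv-complete (t ⟪ u ⟫) d with _ , _ , _ , d₁ , d₂ , p ← es⁻¹ d =
  conv p (≈-refl _) (es (cbv-complete t d₁) (cbv-complete u d₂))

theorem4p8 : ∀ (n : ℕ) (t : Λ n) (Γ : Ctx n) (σ : Ty) →
    ((Γ ⊢ᴺ t ∶ σ) ⇔ (Γ ⊢ᵁ cbn t ∶ σ)) × ((Γ ⊢ⱽ t ∶ σ) ⇔ (Γ ⊢ᵁ cbv t ∶ σ))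
theorem4p8 n t Γ σ = mk⇔ cbn-sound (cbn-complete t) , mk⇔ cbv-sound (cbv-complete t)
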